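{- Consider a permutation gridded in the descending $(\operatorname{Av}(213),\operatorname{Av}(132))$ staircase with cells $1,2,3,\dots$, decomposed so that, for $j\ge 0$, cells $6j+1,6j+2$ form a vertical domino, cells $6j+4,6j+5$ form a horizontal domino, and cells $6j+3$ and $6j+6$ are connecting cells. Suppose that for every cell of a domino, its non-leaves lie between consecutive skew components of the adjacent connecting cell (its leaves being free). Then the gridded permutation avoids $1324$.
   Context: Staircase griddings. The points of the permutation are assigned to cells $1,2,3,\dots$ so that: odd cells avoid $213$ and even cells avoid $132$; for $k$ odd, every point of cell $k$ has larger value than every point of cell $k+1$, positions interleaving freely (cells $k,k+1$ share a column, a $(V)$ pair); for $k$ even, every point of cell $k$ precedes in position every point of cell $k+1$, values interleaving freely (cells $k,k+1$ share a row, an $(H)$ pair); and if $j\ge i+2$, every point of cell $i$ is both earlier in position and larger in value than every point of cell $j$. Dominoes. A vertical domino is a $(V)$ pair of cells (upper cell avoiding $213$, lower avoiding $132$) whose union avoids $1324$; a horizontal domino is an $(H)$ pair of cells (left cell avoiding $132$, right cell avoiding $213$) whose union avoids $1324$. Leaves. The leaves of a cell avoiding $213$ are its right-to-left maxima; the leaves of a cell avoiding $132$ are its left-to-right minima (both computed within the cell). Other points are non-leaves. Every permutation is uniquely a skew sum of skew indecomposables, its skew components. For a domino cell and the connecting cell whose index differs from its own by one (if there is one; cell $1$ has none), "lies between consecutive skew components" is read on the axis along which the two cells interleave: in value if they form an $(H)$ pair (cells of vertical dominoes), in position if they form a $(V)$ pair (cells of horizontal dominoes). It means that no skew component of the connecting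 cell has points both before and after the given point along that axis; the two exterior positions, before all components and after all components, are allowed. -}

module Defs where

open import Data.Fin.Base using (Fin; _<_)
open import Data.Fin.Permutation using (Permutation′; _⟨$⟩ʳ_)
open import Data.Fin.Subset using (Subset; _∈_; _∪_; ⋃; Nonempty)
open import Data.List.Base using (List)
import Data.List.Membership.Propositional as List
open import Data.List.Relation.Unary.All using (All)
open import Data.List.Relation.Unary.AllPairs using (AllPairs)
open import Data.Nat.Base as ℕ using (ℕ; suc; _+_; _*_; _≤_; _⊓_; parity)
open import Data.Nat.Properties using (_≟_)
open import Data.Parity.Base using (Parity; 0ℙ; 1ℙ)
open import Data.Product.Base using (∃; ∃₂; _×_)
open import Data.Sum.Base using (_⊎_)
open import Data.Vec.Base using (Vec; []; _∷_; lookup; tabulate)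
open import Function.Bundles using (_⇔_)
open import Relation.Binary.Core using (_Preserves_⟶_)
open import Relation.Binary.PropositionalEquality.Core using (_≡_)
open import Relation.Nullary.Decidable.Core using (does)
open import Relation.Nullary.Negation.Core using (¬_)

-- A pattern is written in one-line notation.
Pattern : ℕ → Set
Pattern = Vec ℕ

p213 p132 : Pattern 3
p213 = 2 ∷ 1 ∷ 3 ∷ []
p132 = 1 ∷ 3 ∷ 2 ∷ []

p1324 : Pattern 4
p1324 = 1 ∷ 3 ∷ 2 ∷ 4 ∷ []

-- A point of π is named by its position i; its value is π ⟨$⟩ʳ i.
-- A set of points stands for the permutation order-isomorphic to it.
module _ {n : ℕ} (π : Permutation′ n) where

  position value : Fin n → Fin n
  position i = i
  value    i = π ⟨$⟩ʳ i

  record Occurrence {k} (σ : Pattern k) (S : Subset n) : Set where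
    field
      points     : Fin k → Fin n
      within     : ∀ a → points a ∈ S
      increasing : points Preserves _<_ ⟶ _<_
      orderIso   : ∀ a b → lookup σ a ℕ.< lookup σ b ⇔ value (points a) < value (points b)

  Avoids : ∀ {k} → Pattern k → Subset n → Set
  Avoids σ S = ¬ Occurrence σ S

  Precedes Above SkewBefore : Subset n → Subset n → Set
  Precedes   A B = ∀ {i j} → i ∈ A → j ∈ B → position i < position j
  Above      A B = ∀ {i j} → i ∈ A → j ∈ B → value j < value i
  SkewBefore A B = Precedes A B × Above A B

  SkewDecomposable : Subset n → Set
  SkewDecomposable S =
    ∃₂ λ A B → Nonempty A × Nonempty B × SkewBefore A B × A ∪ B ≡ S

  -- The empty permutation is not counted as skew indecomposable: it is the
  -- empty skew sum.
  SkewIndecomposable : Subset n → Set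
  SkewIndecomposable S = Nonempty S × ¬ SkewDecomposable S

  record IsSkewDecomposition (S : Subset n) (Cs : List (Subset n)) : Set where
    field
      indecomposable : All SkewIndecomposable Cs
      skewOrdered    : AllPairs SkewBefore Cs
      union          : ⋃ Cs ≡ S

  SkewComponent : Subset n → Subset n → Set
  SkewComponent S C = ∃ λ Cs → IsSkewDecomposition S Cs × C List.∈ Cs

  LiesBetweenSkewComponents : (Fin n → Fin n) → Subset n → Fin n → Set
  LiesBetweenSkewComponents coord S p =
    ∀ C → SkewComponent S C →
    ¬ (∃₂ λ a b → a ∈ C × b ∈ C × coord a < coord p × coord p < coord b)

  RightToLeftMaximum LeftToRightMinimum : Subset n → Fin n → Set
  RightToLeftMaximum S p =
    p ∈ S × (∀ {q} → q ∈ S → position p < position q → value q < value p)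
  LeftToRightMinimum S p =
    p ∈ S × (∀ {q} → q ∈ S → position q < position p → value p < value q)

  record VerticalDomino (upper lower : Subset n) : Set where
    field
      above       : Above upper lower
      upperAvoids : Avoids p213 upper
      lowerAvoids : Avoids p132 lower
      unionAvoids : Avoids p1324 (upper ∪ lower)

  record HorizontalDomino (left right : Subset n) : Set where
    field
      precedes    : Precedes left right
      leftAvoids  : Avoids p132 left
      rightAvoids : Avoids p213 right
      unionAvoids : Avoids p1324 (left ∪ right)

cellPattern : Parity → Pattern 3
cellPattern 0ℙ = p132
cellPattern 1ℙ = p213

leaf : ∀ {n} → Permutation′ n → Parity → Subset n → Fin n → Set
leaf π 0ℙ = LeftToRightMinimum π
leaf π 1ℙ = RightToLeftMaximum π

-- Cells k and k + 1 share a column for k odd, so their positions interleave;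
-- they share a row for k even, so their values interleave.
coordinate : ∀ {n} → Permutation′ n → Parity → Fin n → Fin n
coordinate π 0ℙ = value π
coordinate π 1ℙ = position π

-- A gridding is the map c sending each point to the index of its cell.
module _ {n : ℕ} (π : Permutation′ n) (c : Fin n → ℕ) where

  cell : ℕ → Subset n
  cell k = tabulate λ i → does (c i ≟ k)

  record IsStaircaseGridding : Set where
    field
      -- Cells are numbered from 1.
      positive   : ∀ i → 1 ≤ c i
      avoids     : ∀ k → Avoids π (cellPattern (parity k)) (cell k)
      vertical   : ∀ k → parity k ≡ 1ℙ → Above π (cell k) (cell (suc k))
      horizontal : ∀ k → parity k ≡ 0ℙ → Precedes π (cell k) (cell (suc k))
      descending : ∀ i j → i + 2 ≤ j → SkewBefore π (cell i) (cell j)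

  record IsDominoDecomposition : Set where
    field
      vertical   : ∀ j → VerticalDomino π (cell (6 * j + 1)) (cell (6 * j + 2))
      horizontal : ∀ j → HorizontalDomino π (cell (6 * j + 4)) (cell (6 * j + 5))

  IsLeaf : ℕ → Fin n → Set
  IsLeaf k = leaf π (parity k) (cell k)

  IsNonLeaf : ℕ → Fin n → Set
  IsNonLeaf k p = p ∈ cell k × ¬ IsLeaf k p

DominoCell ConnectingCell : ℕ → Set
DominoCell k =
  ∃ λ j → k ≡ 6 * j + 1 ⊎ k ≡ 6 * j + 2 ⊎ k ≡ 6 * j + 4 ⊎ k ≡ 6 * j + 5
ConnectingCell k = ∃ λ j → k ≡ 6 * j + 3 ⊎ k ≡ 6 * j + 6

Adjacent : ℕ → ℕ → Set
Adjacent k l = l ≡ suc k ⊎ k ≡ suc l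

-- The axis is fixed by the smaller index of the adjacent cells k and l.
NonLeavesLieBetween : ∀ {n} → Permutation′ n → (Fin n → ℕ) → ℕ → ℕ → Set
NonLeavesLieBetween π c k l =
  ∀ p → IsNonLeaf π c k p →
  LiesBetweenSkewComponents π (coordinate π (parity (k ⊓ l))) (cell π c l) p

{-# OPTIONS --safe #-}

-- The points of a 1324 are pairwise increasing except for the middle two, so
-- its cells pairwise differ in index by at most one, hence lie in {k, k + 1}
-- for some k.  If these two cells form a domino there is nothing to show.
-- Otherwise, as cells k and k + 1 avoid 213 and 132 in some order, each of them
-- contains exactly two of the four points, and these two form a 12.  Along the
-- axis on which the cells interleave, the two pairs alternate, so each of the
-- middle points 3 and 2 of the 1324 lies strictly between the points of the
-- other cell's pair; both are non-leaves.  But a 12 of the connecting cell lies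
-- in a single skew component, which may not surround a non-leaf.
module Submission where

open import Defs
open import Data.Nat.Base as ℕ using (ℕ; suc; s<s; parity; _⊓_)
import Data.Nat.Properties as ℕ
open import Data.Nat.DivMod using (_divMod_; result)
open import Data.Fin.Base using (Fin; _<_; suc; toℕ; inject₁)
open import Data.Fin.Patterns using (0F; 1F; 2F; 3F; 4F; 5F)
open import Data.Fin.Permutation using (Permutation′)
open import Data.Fin.Properties using (_<?_; <-asym; <-irrefl; all?)
open import Data.Fin.Subset
  using (Subset; ⊤; _∈_; _∪_; _⊆_; _⊂_; ⋃; Nonempty)
open import Data.Fin.Subset.Induction using (⊂-wellFounded)
open import Data.Fin.Subset.Properties
  using (nonempty?; Empty-unique; ∉⊥; p⊆p∪q; q⊆p∪q; x∈p∪q⁻; x∈p∪q⁺;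
         ∪-assoc; ∪-identityˡ; ∪-identityʳ)
open import Data.List.Base using (List; []; _∷_; [_]; _++_; allFin)
open import Data.List.Extrema.Nat using (argmin; f[argmin]≤f[xs])
import Data.List.Membership.Propositional as List
open import Data.List.Membership.Propositional.Properties using (∈-allFin)
open import Data.List.Relation.Unary.All as All using (All; []; _∷_)
import Data.List.Relation.Unary.All.Properties as All using (++⁺)
open import Data.List.Relation.Unary.AllPairs using (AllPairs; []; _∷_)
import Data.List.Relation.Unary.AllPairs.Properties as AllPairs
open import Data.List.Relation.Unary.Any using (here; there)
open import Data.Parity.Base using (0ℙ; 1ℙ; _⁻¹)
open import Data.Parity.Properties using (suc-homo-⁻¹; ⁻¹-selfInverse)
open import Data.Product.Base using (∃; ∃₂; _×_; _,_; proj₁; proj₂)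
open import Data.Sum.Base as Sum using (_⊎_; inj₁; inj₂; swap)
open import Data.Vec.Base using (lookup)
open import Data.Vec.Properties using (lookup∘tabulate; lookup⇒[]=)
open import Function.Base using (_∘_)
open import Function.Bundles using (mk⇔; Equivalence)
import Induction.WellFounded as WF
open import Level using (0ℓ)
open import Relation.Binary.PropositionalEquality
  using (_≡_; refl; sym; trans; cong; subst; subst₂)
open import Relation.Nullary.Decidable
  using (Dec; yes; no; True; toWitness; from-yes; dec-true; _→-dec_; ¬¬-excluded-middle)
open import Relation.Nullary.Negation using (¬_; contradiction)

-- Unions of lists of subsets.

⋃-++ : ∀ {n} (As Bs : List (Subset n)) → ⋃ (As ++ Bs) ≡ ⋃ As ∪ ⋃ Bs
⋃-++ []       Bs = sym (∪-identityˡ _)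
⋃-++ (A ∷ As) Bs = trans (cong (A ∪_) (⋃-++ As Bs)) (sym (∪-assoc A _ _))

∈⇒⊆⋃ : ∀ {n} {A : Subset n} {As} → A List.∈ As → A ⊆ ⋃ As
∈⇒⊆⋃ {As = _ ∷ As} (here refl) = p⊆p∪q (⋃ As)
∈⇒⊆⋃ {As = B ∷ As} (there A∈)  = q⊆p∪q B (⋃ As) ∘ ∈⇒⊆⋃ A∈

∈⋃⁻ : ∀ {n} {x : Fin n} As → x ∈ ⋃ As → ∃ λ A → A List.∈ As × x ∈ A
∈⋃⁻ []       x∈ = contradiction x∈ ∉⊥
∈⋃⁻ (A ∷ As) x∈ with x∈p∪q⁻ A (⋃ As) x∈
... | inj₁ x∈A  = A , here refl , x∈A
... | inj₂ x∈As = let B , B∈ , x∈B = ∈⋃⁻ As x∈As in B , there B∈ , x∈B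

-- Ascents and skew components.

module _ {n : ℕ} (π : Permutation′ n) where

  Ascent : Fin n → Fin n → Set
  Ascent p q = p < q × value π p < value π q

  -- This and its mirror image let the recursion in `skewDecomposition` descend to both summands: a
  -- point common to both would have to precede itself.
  skewBefore⇒⊂ˡ : ∀ {A B} → Nonempty B → SkewBefore π A B → A ⊂ A ∪ B
  skewBefore⇒⊂ˡ {A} {B} (b , b∈B) (A<B , _) =
    p⊆p∪q B , b , q⊆p∪q A B b∈B , λ b∈A → <-irrefl refl (A<B b∈A b∈B)

  skewBefore⇒⊂ʳ : ∀ {A B} → Nonempty A → SkewBefore π A B → B ⊂ A ∪ B
  skewBefore⇒⊂ʳ {A} {B} (a , a∈A) (A<B , _) =
    q⊆p∪q A B , a , p⊆p∪q B a∈A , λ a∈B → <-irrefl refl (A<B a∈A a∈B)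

  module _ {A B : Subset n} (A≫B : SkewBefore π A B) where
    open IsSkewDecomposition

    -- Each block lies inside `A` or inside `B`, so pairs of blocks across the two lists inherit
    -- their order from `A≫B`.
    ++-isSkewDecomposition : ∀ {As Bs} →
      IsSkewDecomposition π A As → IsSkewDecomposition π B Bs →
      IsSkewDecomposition π (A ∪ B) (As ++ Bs)
    ++-isSkewDecomposition {As} {Bs} dA dB = record
      { indecomposable = All.++⁺ (indecomposable dA) (indecomposable dB)
      ; skewOrdered    = AllPairs.++⁺ (skewOrdered dA) (skewOrdered dB)
          (All.tabulate λ C∈ → All.tabulate λ D∈ →
            (λ i∈ j∈ → proj₁ A≫B (inA C∈ i∈) (inB D∈ j∈)) ,
            (λ i∈ j∈ → proj₂ A≫B (inA C∈ i∈) (inB D∈ j∈)))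
      ; union          = trans (⋃-++ As Bs) (subst₂ (λ X Y → ⋃ As ∪ ⋃ Bs ≡ X ∪ Y)
                                               (union dA) (union dB) refl)
      }
      where
      inA : ∀ {C} → C List.∈ As → C ⊆ A
      inA C∈ {x} x∈ = subst (x ∈_) (union dA) (∈⇒⊆⋃ C∈ x∈)
      inB : ∀ {D} → D List.∈ Bs → D ⊆ B
      inB D∈ {x} x∈ = subst (x ∈_) (union dB) (∈⇒⊆⋃ D∈ x∈)

  -- The double negation spares a decision procedure for SkewDecomposable.
  skewDecomposition : ∀ S → ¬ ¬ ∃ (IsSkewDecomposition π S)
  skewDecomposition = wfRec _ step
    where
    open WF.All ⊂-wellFounded 0ℓ
    step : ∀ S → (∀ {T} → T ⊂ S → ¬ ¬ ∃ (IsSkewDecomposition π T)) →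
           ¬ ¬ ∃ (IsSkewDecomposition π S)
    step S rec k with nonempty? S
    ... | no  empty = k ([] , record
      { indecomposable = [] ; skewOrdered = [] ; union = sym (Empty-unique empty) })
    ... | yes nonempty = ¬¬-excluded-middle λ where
      (no  indecomposable) → k ([ S ] , record
        { indecomposable = (nonempty , indecomposable) ∷ []
        ; skewOrdered    = [] ∷ []
        ; union          = ∪-identityʳ S })
      (yes (A , B , neA , neB , A≫B , refl)) →
        rec (skewBefore⇒⊂ˡ neB A≫B) λ (As , dA) →
        rec (skewBefore⇒⊂ʳ neA A≫B) λ (Bs , dB) →
        k (As ++ Bs , ++-isSkewDecomposition A≫B dA dB)

  -- Points in different blocks form a descent: one order of the blocks contradicts the values of
  -- the ascent, the other its positions.
  ascent-in-block : ∀ {Cs p q} → AllPairs (SkewBefore π) Cs → Ascent p q →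
    p ∈ ⋃ Cs → q ∈ ⋃ Cs → ∃ λ C → C List.∈ Cs × p ∈ C × q ∈ C
  ascent-in-block {[]} _ _ p∈ _ = contradiction p∈ ∉⊥
  ascent-in-block {C ∷ Cs} (C≫ ∷ ordered) asc p∈ q∈
    with x∈p∪q⁻ C (⋃ Cs) p∈ | x∈p∪q⁻ C (⋃ Cs) q∈
  ... | inj₁ p∈C  | inj₁ q∈C  = C , here refl , p∈C , q∈C
  ... | inj₂ p∈Cs | inj₂ q∈Cs =
    let D , D∈ , p∈D , q∈D = ascent-in-block ordered asc p∈Cs q∈Cs
    in D , there D∈ , p∈D , q∈D
  ... | inj₁ p∈C  | inj₂ q∈Cs =
    let D , D∈ , q∈D = ∈⋃⁻ Cs q∈Cs
    in contradiction (proj₂ (All.lookup C≫ D∈) p∈C q∈D) (<-asym (proj₂ asc))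
  ... | inj₂ p∈Cs | inj₁ q∈C  =
    let D , D∈ , p∈D = ∈⋃⁻ Cs p∈Cs
    in contradiction (proj₁ (All.lookup C≫ D∈) q∈C p∈D) (<-asym (proj₁ asc))

  ascent-blocks : ∀ coord {S a b p} → a ∈ S → b ∈ S → Ascent a b →
    coord a < coord p → coord p < coord b → ¬ LiesBetweenSkewComponents π coord S p
  ascent-blocks coord {S} {a} {b} a∈ b∈ asc a<p p<b between =
    -- The goal is absurdity, so a doubly negated decomposition suffices; its block containing `a`
    -- and `b` surrounds `p`.
    skewDecomposition S λ (Cs , d) →
      let open IsSkewDecomposition d
          C , C∈ , a∈C , b∈C = ascent-in-block skewOrdered asc
            (subst (a ∈_) (sym union) a∈) (subst (b ∈_) (sym union) b∈)
      in between C (Cs , d , C∈) (a , b , a∈C , b∈C , a<p , p<b)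

  ascent⇒¬rightToLeftMaximum : ∀ {S p q} → q ∈ S → Ascent p q → ¬ RightToLeftMaximum π S p
  ascent⇒¬rightToLeftMaximum q∈ (p<q , vp<vq) (_ , max) = <-asym vp<vq (max q∈ p<q)

  ascent⇒¬leftToRightMinimum : ∀ {S p q} → p ∈ S → Ascent p q → ¬ LeftToRightMinimum π S q
  ascent⇒¬leftToRightMinimum p∈ (p<q , vp<vq) (_ , min) = <-asym vp<vq (min p∈ p<q)

  -- Occurrences and subpatterns.

  open Occurrence

  module _ {k} {σ : Pattern k} {S : Subset n} (occ : Occurrence π σ S) where

    relocate : ∀ {T} → (∀ a → points occ a ∈ T) → Occurrence π σ T
    relocate within′ = record
      { points = points occ ; within = within′
      ; increasing = increasing occ ; orderIso = orderIso occ }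

    -- For literal indices the `True` argument is found by evaluation, so uses name only the two
    -- entries compared.
    position-< : ∀ a b {a<b : True (a <? b)} → points occ a < points occ b
    position-< a b {a<b} = increasing occ (toWitness a<b)

    value-< : ∀ a b {σa<σb : True (lookup σ a ℕ.<? lookup σ b)} →
              value π (points occ a) < value π (points occ b)
    value-< a b {σa<σb} = Equivalence.to (orderIso occ a b) (toWitness σa<σb)

    ascent : ∀ a b {a<b : True (a <? b)} {σa<σb : True (lookup σ a ℕ.<? lookup σ b)} →
             Ascent (points occ a) (points occ b)
    ascent a b {a<b} {σa<σb} = position-< a b {a<b} , value-< a b {σa<σb}

  subpattern : ∀ {k m} {σ : Pattern k} {τ : Pattern m} {S T} (ι : Fin m → Fin k) →
    (∀ a b → a < b → ι a < ι b) →
    (∀ a b → lookup τ a ℕ.< lookup τ b → lookup σ (ι a) ℕ.< lookup σ (ι b)) →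
    (∀ a b → lookup σ (ι a) ℕ.< lookup σ (ι b) → lookup τ a ℕ.< lookup τ b) →
    (occ : Occurrence π σ S) → (∀ a → points occ (ι a) ∈ T) → Occurrence π τ T
  subpattern ι mono to from occ within′ = record
    { points     = points occ ∘ ι
    ; within     = within′
    ; increasing = increasing occ ∘ mono _ _
    ; orderIso   = λ a b → mk⇔ (Equivalence.to (orderIso occ (ι a) (ι b)) ∘ to a b)
                               (from a b ∘ Equivalence.from (orderIso occ (ι a) (ι b)))
    }

  private
    -- The index set is finite, so comparisons of concrete patterns can be settled by evaluation
    -- through `from-yes`.
    decide : ∀ {m} {P Q : Fin m → Fin m → Set} →
      (∀ a b → Dec (P a b)) → (∀ a b → Dec (Q a b)) → Dec (∀ a b → P a b → Q a b)
    decide P? Q? = all? λ a → all? λ b → P? a b →-dec Q? a b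

    lt? : ∀ {m} (σ : Pattern m) a b → Dec (lookup σ a ℕ.< lookup σ b)
    lt? σ a b = lookup σ a ℕ.<? lookup σ b

  module _ {S T : Subset n} (occ : Occurrence π p1324 S) where

    -- Deleting the final 4 leaves 132.
    1324⇒132 : points occ 0F ∈ T → points occ 1F ∈ T → points occ 2F ∈ T →
               Occurrence π p132 T
    1324⇒132 0∈ 1∈ 2∈ = subpattern inject₁
      (from-yes (decide {m = 3} {P = _<_} _<?_ λ a b → inject₁ a <? inject₁ b))
      (from-yes (decide (lt? p132) λ a b → lt? p1324 (inject₁ a) (inject₁ b)))
      (from-yes (decide (λ a b → lt? p1324 (inject₁ a) (inject₁ b)) (lt? p132)))
      occ λ { 0F → 0∈ ; 1F → 1∈ ; 2F → 2∈ }

    -- Deleting the initial 1 leaves 324, which is order-isomorphic to 213.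
    1324⇒213 : points occ 1F ∈ T → points occ 2F ∈ T → points occ 3F ∈ T →
               Occurrence π p213 T
    1324⇒213 1∈ 2∈ 3∈ = subpattern suc
      (λ _ _ → s<s)
      (from-yes (decide (lt? p213) λ a b → lt? p1324 (suc a) (suc b)))
      (from-yes (decide (λ a b → lt? p1324 (suc a) (suc b)) (lt? p213)))
      occ λ { 0F → 1∈ ; 1F → 2∈ ; 2F → 3∈ }

  -- Two cells sharing a row or a column.

  module _ (coord : Fin n → Fin n) {A B : Subset n}
           (A<B : ∀ {i j} → i ∈ A → j ∈ B → coord i < coord j) where

    -- Applied along the separating axis: `position` for cells in one row, `value` for cells in one
    -- column.
    downward : ∀ {p q} → p ∈ A ⊎ p ∈ B → coord p < coord q → q ∈ A → p ∈ A
    downward (inj₁ p∈A) _   _   = p∈A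
    downward (inj₂ p∈B) p<q q∈A = contradiction (A<B q∈A p∈B) (<-asym p<q)

    upward : ∀ {p q} → q ∈ A ⊎ q ∈ B → coord p < coord q → p ∈ B → q ∈ B
    upward (inj₂ q∈B) _   _   = q∈B
    upward (inj₁ q∈A) p<q p∈B = contradiction (A<B q∈A p∈B) (<-asym p<q)

  module _ {L R : Subset n} (L<R : Precedes π L R)
           (L-avoids : Avoids π p132 L) (R-avoids : Avoids π p213 R) where

    -- Positions cut the occurrence into a prefix in `L` and a suffix in `R`. A prefix of three or
    -- more points contains 132, a suffix of three or more contains 213, so the cut is in the
    -- middle.
    horizontal-split : (occ : Occurrence π p1324 (L ∪ R)) →
      (points occ 0F ∈ L × points occ 1F ∈ L) × (points occ 2F ∈ R × points occ 3F ∈ R)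
    horizontal-split occ = split (side 1F) (side 2F)
      where
      side : ∀ a → points occ a ∈ L ⊎ points occ a ∈ R
      side a = x∈p∪q⁻ L R (within occ a)
      left : ∀ a b {a<b : True (a <? b)} → points occ b ∈ L → points occ a ∈ L
      left a b {a<b} = downward (position π) L<R (side a) (position-< occ a b {a<b})
      right : ∀ a b {a<b : True (a <? b)} → points occ a ∈ R → points occ b ∈ R
      right a b {a<b} = upward (position π) L<R (side b) (position-< occ a b {a<b})
      split : points occ 1F ∈ L ⊎ points occ 1F ∈ R →
              points occ 2F ∈ L ⊎ points occ 2F ∈ R → _
      split (inj₁ 1∈L) (inj₁ 2∈L) =
        contradiction (1324⇒132 occ (left 0F 1F 1∈L) 1∈L 2∈L) L-avoids
      split (inj₁ 1∈L) (inj₂ 2∈R) = (left 0F 1F 1∈L , 1∈L) , (2∈R , right 2F 3F 2∈R)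
      split (inj₂ 1∈R) _          =
        contradiction (1324⇒213 occ 1∈R (right 1F 2F 1∈R) (right 1F 3F 1∈R)) R-avoids

    -- The 3 is a non-leaf of `L` because of the 1, and its value is between the 2 and 4 in `R`. The
    -- 2 is a non-leaf of `R` because of the 4, and its value is between the 1 and 3 in `L`.
    horizontal-avoids :
      (∀ p → p ∈ L → ¬ LeftToRightMinimum π L p →
        LiesBetweenSkewComponents π (value π) R p) ⊎
      (∀ p → p ∈ R → ¬ RightToLeftMaximum π R p →
        LiesBetweenSkewComponents π (value π) L p) →
      Avoids π p1324 (L ∪ R)
    horizontal-avoids nonleaves occ with nonleaves | horizontal-split occ
    ... | inj₁ between | (0∈L , 1∈L) , (2∈R , 3∈R) =
      ascent-blocks (value π) 2∈R 3∈R (ascent occ 2F 3F) (value-< occ 2F 1F) (value-< occ 1F 3F)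
        (between _ 1∈L (ascent⇒¬leftToRightMinimum 0∈L (ascent occ 0F 1F)))
    ... | inj₂ between | (0∈L , 1∈L) , (2∈R , 3∈R) =
      ascent-blocks (value π) 0∈L 1∈L (ascent occ 0F 1F) (value-< occ 0F 2F) (value-< occ 2F 1F)
        (between _ 2∈R (ascent⇒¬rightToLeftMaximum 3∈R (ascent occ 2F 3F)))

  module _ {U W : Subset n} (U>W : Above π U W)
           (U-avoids : Avoids π p213 U) (W-avoids : Avoids π p132 W) where

    -- Here the cut is by value. A 2 in `U` brings 3 and 4 with it, giving 213; a 3 in `W` brings 1
    -- and 2 with it, giving 132.
    vertical-split : (occ : Occurrence π p1324 (U ∪ W)) →
      (points occ 0F ∈ W × points occ 2F ∈ W) × (points occ 1F ∈ U × points occ 3F ∈ U)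
    vertical-split occ = split (side 1F) (side 2F)
      where
      side : ∀ a → points occ a ∈ W ⊎ points occ a ∈ U
      side a = swap (x∈p∪q⁻ U W (within occ a))
      W<U : ∀ {i j} → i ∈ W → j ∈ U → value π i < value π j
      W<U i∈W j∈U = U>W j∈U i∈W
      lower : ∀ a b {σa<σb : True (lookup p1324 a ℕ.<? lookup p1324 b)} →
              points occ b ∈ W → points occ a ∈ W
      lower a b {σa<σb} = downward (value π) W<U (side a) (value-< occ a b {σa<σb})
      upper : ∀ a b {σa<σb : True (lookup p1324 a ℕ.<? lookup p1324 b)} →
              points occ a ∈ U → points occ b ∈ U
      upper a b {σa<σb} = upward (value π) W<U (side b) (value-< occ a b {σa<σb})
      split : points occ 1F ∈ W ⊎ points occ 1F ∈ U →
              points occ 2F ∈ W ⊎ points occ 2F ∈ U → _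
      split _          (inj₂ 2∈U) =
        contradiction (1324⇒213 occ (upper 2F 1F 2∈U) 2∈U (upper 2F 3F 2∈U)) U-avoids
      split (inj₁ 1∈W) (inj₁ 2∈W) =
        contradiction (1324⇒132 occ (lower 0F 2F 2∈W) 1∈W 2∈W) W-avoids
      split (inj₂ 1∈U) (inj₁ 2∈W) = (lower 0F 2F 2∈W , 2∈W) , (1∈U , upper 1F 3F 1∈U)

    -- From left to right the points alternate between `W` and `U`. The 3 is a non-leaf because of
    -- the 4 and stands between 1 and 2; the 2 is a non-leaf because of the 1 and stands between 3
    -- and 4.
    vertical-avoids :
      (∀ p → p ∈ U → ¬ RightToLeftMaximum π U p →
        LiesBetweenSkewComponents π (position π) W p) ⊎
      (∀ p → p ∈ W → ¬ LeftToRightMinimum π W p →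
        LiesBetweenSkewComponents π (position π) U p) →
      Avoids π p1324 (U ∪ W)
    vertical-avoids nonleaves occ with nonleaves | vertical-split occ
    ... | inj₁ between | (0∈W , 2∈W) , (1∈U , 3∈U) =
      ascent-blocks (position π) 0∈W 2∈W (ascent occ 0F 2F)
        (position-< occ 0F 1F) (position-< occ 1F 2F)
        (between _ 1∈U (ascent⇒¬rightToLeftMaximum 3∈U (ascent occ 1F 3F)))
    ... | inj₂ between | (0∈W , 2∈W) , (1∈U , 3∈U) =
      ascent-blocks (position π) 1∈U 3∈U (ascent occ 1F 3F)
        (position-< occ 1F 2F) (position-< occ 2F 3F)
        (between _ 2∈W (ascent⇒¬leftToRightMinimum 0∈W (ascent occ 0F 2F)))

-- Arithmetic of cell indices.

⇒6*j+1+r : ∀ k → 1 ℕ.≤ k → ∃₂ λ j (r : Fin 6) → k ≡ 6 ℕ.* j ℕ.+ suc (toℕ r)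
-- Dividing the predecessor makes the offsets run from 1 to 6, so that 6j+6 stays in block `j`.
⇒6*j+1+r (suc m) _ with m divMod 6
... | result j r m≡ = j , r , trans (cong suc (trans m≡ (trans (ℕ.+-comm (toℕ r) _)
                                (cong (ℕ._+ toℕ r) (ℕ.*-comm j 6)))))
                              (sym (ℕ.+-suc (6 ℕ.* j) (toℕ r)))

-- The equation for `suc k` is recorded as well, since `suc (6 * j + 1)` does not reduce to
-- `6 * j + 2`.
ConsecutiveCells : ℕ → Set
ConsecutiveCells k =
  ((∃ λ j → k ≡ 6 ℕ.* j ℕ.+ 1 × suc k ≡ 6 ℕ.* j ℕ.+ 2) ⊎
   (∃ λ j → k ≡ 6 ℕ.* j ℕ.+ 4 × suc k ≡ 6 ℕ.* j ℕ.+ 5)) ⊎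
  (DominoCell k × ConnectingCell (suc k) ⊎ DominoCell (suc k) × ConnectingCell k)

consecutive-cells : ∀ k → 1 ℕ.≤ k → ConsecutiveCells k
consecutive-cells k 1≤k with ⇒6*j+1+r k 1≤k
... | j , r , refl = cases r
  where
  next : ∀ r → suc (6 ℕ.* j ℕ.+ r) ≡ 6 ℕ.* j ℕ.+ suc r
  next r = sym (ℕ.+-suc (6 ℕ.* j) r)
  wrap : suc (6 ℕ.* j ℕ.+ 6) ≡ 6 ℕ.* suc j ℕ.+ 1
  wrap = trans (next 6) (trans (ℕ.+-comm (6 ℕ.* j) 7)
           (trans (cong suc (sym (ℕ.*-suc 6 j))) (ℕ.+-comm 1 _)))
  cases : ∀ r → ConsecutiveCells (6 ℕ.* j ℕ.+ suc (toℕ r))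
  cases 0F = inj₁ (inj₁ (j , refl , next 1))
  cases 1F = inj₂ (inj₁ ((j , inj₂ (inj₁ refl)) , (j , inj₁ (next 2))))
  cases 2F = inj₂ (inj₂ ((j , inj₂ (inj₂ (inj₁ (next 3)))) , (j , inj₁ refl)))
  cases 3F = inj₁ (inj₂ (j , refl , next 4))
  cases 4F = inj₂ (inj₁ ((j , inj₂ (inj₂ (inj₂ refl))) , (j , inj₂ (next 5))))
  -- The successor of the connecting cell 6j+6 opens the next block, hence the witness `suc j`.
  cases 5F = inj₂ (inj₂ ((suc j , inj₁ wrap) , (j , inj₂ refl)))

parity-suc : ∀ k {p} → parity k ≡ p → parity (suc k) ≡ p ⁻¹
parity-suc k refl = sym (⁻¹-selfInverse (suc-homo-⁻¹ k))

pairwise-near⇒consecutive : ∀ {m} (f : Fin (suc m) → ℕ) →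
  (∀ i j → f i ℕ.≤ suc (f j)) → ∃ λ i → ∀ j → f j ≡ f i ⊎ f j ≡ suc (f i)
pairwise-near⇒consecutive f near = i , λ j → side (near j i) (All.lookup
    (f[argmin]≤f[xs] {f = f} 0F (allFin _)) (∈-allFin j))
  where
  -- An index of smallest value; `0F` is the default that `argmin` needs, available because the
  -- index set is nonempty.
  i = argmin f 0F (allFin _)
  side : ∀ {x y} → x ℕ.≤ suc y → y ℕ.≤ x → x ≡ y ⊎ x ≡ suc y
  side x≤1+y y≤x with ℕ.m≤n⇒m<n∨m≡n y≤x
  ... | inj₁ y<x = inj₂ (ℕ.≤-antisym x≤1+y y<x)
  ... | inj₂ y≡x = inj₁ (sym y≡x)

-- Consecutive cells of a gridding.

module _ {n : ℕ} (π : Permutation′ n) (c : Fin n → ℕ) where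

  ∈cell : ∀ {i k} → c i ≡ k → i ∈ cell π c k
  ∈cell {i} {k} ci≡k =
    lookup⇒[]= i _ (trans (lookup∘tabulate _ i) (dec-true (c i ℕ.≟ k) ci≡k))

  -- `leaf` and `coordinate` compute only on a known parity; naming the parities `p` and `q` lets
  -- both reduce after a case split.
  nonLeavesLieBetween : ∀ {k l p q} → parity k ≡ p → parity (k ⊓ l) ≡ q →
    NonLeavesLieBetween π c k l →
    ∀ x → x ∈ cell π c k → ¬ leaf π p (cell π c k) x →
    LiesBetweenSkewComponents π (coordinate π q) (cell π c l) x
  nonLeavesLieBetween refl refl between x x∈ ¬leaf = between x (x∈ , ¬leaf)

  module _ (gridding : IsStaircaseGridding π c) where
    open IsStaircaseGridding gridding

    consecutive-avoids : ∀ k →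
      NonLeavesLieBetween π c k (suc k) ⊎ NonLeavesLieBetween π c (suc k) k →
      Avoids π p1324 (cell π c k ∪ cell π c (suc k))
    consecutive-avoids k nonleaves = byParity _ refl
      where
      cell-avoids : ∀ l {p} → parity l ≡ p → Avoids π (cellPattern p) (cell π c l)
      cell-avoids l refl = avoids l
      -- The smaller index fixes the axis, and it is `k` whichever of the two cells has its
      -- non-leaves constrained.
      ⊓ʳ : ∀ {p} → parity k ≡ p → parity (k ⊓ suc k) ≡ p
      ⊓ʳ = trans (cong parity (ℕ.m≤n⇒m⊓n≡m (ℕ.n≤1+n k)))
      ⊓ˡ : ∀ {p} → parity k ≡ p → parity (suc k ⊓ k) ≡ p
      ⊓ˡ = trans (cong parity (ℕ.m≥n⇒m⊓n≡n (ℕ.n≤1+n k)))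
      byParity : ∀ p → parity k ≡ p → Avoids π p1324 (cell π c k ∪ cell π c (suc k))
      byParity 0ℙ even = horizontal-avoids π (horizontal k even)
          (cell-avoids k even) (cell-avoids (suc k) (parity-suc k even))
          (Sum.map (nonLeavesLieBetween even (⊓ʳ even))
                   (nonLeavesLieBetween (parity-suc k even) (⊓ˡ even)) nonleaves)
      byParity 1ℙ odd = vertical-avoids π (vertical k odd)
          (cell-avoids k odd) (cell-avoids (suc k) (parity-suc k odd))
          (Sum.map (nonLeavesLieBetween odd (⊓ʳ odd))
                   (nonLeavesLieBetween (parity-suc k odd) (⊓ˡ odd)) nonleaves)

    -- Locating a 1324 in two consecutive cells.

    far⇒descending : ∀ {p q} → c p ℕ.+ 2 ℕ.≤ c q → p < q × value π q < value π p
    far⇒descending {p} {q} far =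
      let before , above = descending (c p) (c q) far
      in before (∈cell refl) (∈cell refl) , above (∈cell refl) (∈cell refl)

    -- If the index rose by two or more from `p` to `q`, the staircase would force exactly the
    -- excluded descent.
    near : ∀ {p q} → ¬ (p < q × value π q < value π p) → c q ℕ.≤ suc (c p)
    near {p} {q} ¬desc = ℕ.≮⇒≥ λ far →
      ¬desc (far⇒descending (subst (ℕ._≤ c q) (ℕ.+-comm 2 (c p)) far))

    -- An ascent is a descent in neither order; positions refute this direction, values the next.
    ascent⇒nearˡ : ∀ {p q} → Ascent π p q → c p ℕ.≤ suc (c q)
    ascent⇒nearˡ (p<q , _) = near λ (q<p , _) → <-asym p<q q<p

    ascent⇒nearʳ : ∀ {p q} → Ascent π p q → c q ℕ.≤ suc (c p)
    ascent⇒nearʳ (_ , vp<vq) = near λ (_ , vq<vp) → <-asym vp<vq vq<vp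

    module _ {S : Subset n} (occ : Occurrence π p1324 S) where
      open Occurrence occ

      -- Otherwise the four points would lie in cells m + 1, m, m + 2, m + 1,
      -- which is excluded by their positions for m even and by their values
      -- for m odd.
      1324-middle-near : c (points 2F) ℕ.≤ suc (c (points 1F))
      1324-middle-near = ℕ.≮⇒≥ λ far → impossible far _ refl
        where
        m = c (points 1F)
        sandwiched : ∀ {x} → suc (suc m) ℕ.≤ c (points 2F) →
                     c (points 2F) ℕ.≤ suc x → x ℕ.≤ suc m → x ≡ suc m
        sandwiched far 2≤ ≤1 = ℕ.≤-antisym ≤1 (ℕ.s≤s⁻¹ (ℕ.≤-trans far 2≤))
        impossible : suc (suc m) ℕ.≤ c (points 2F) → ∀ p → ¬ parity m ≡ p
        impossible far 0ℙ even = <-asym (position-< π occ 0F 1F)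
          (horizontal m even (∈cell refl) (∈cell
            (sandwiched far (ascent⇒nearʳ (ascent π occ 0F 2F))
                            (ascent⇒nearˡ (ascent π occ 0F 1F)))))
        impossible far 1ℙ odd  = <-asym (value-< π occ 1F 3F)
          (vertical m odd (∈cell refl) (∈cell
            (sandwiched far (ascent⇒nearˡ (ascent π occ 2F 3F))
                            (ascent⇒nearʳ (ascent π occ 1F 3F)))))

      -- Every pair of distinct entries except the middle one is an ascent, which bounds the indices
      -- both ways.
      1324-cells-near : ∀ a b → c (points a) ℕ.≤ suc (c (points b))
      1324-cells-near 0F 0F = ℕ.n≤1+n _
      1324-cells-near 1F 1F = ℕ.n≤1+n _
      1324-cells-near 2F 2F = ℕ.n≤1+n _
      1324-cells-near 3F 3F = ℕ.n≤1+n _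
      1324-cells-near 0F 1F = ascent⇒nearˡ (ascent π occ 0F 1F)
      1324-cells-near 0F 2F = ascent⇒nearˡ (ascent π occ 0F 2F)
      1324-cells-near 0F 3F = ascent⇒nearˡ (ascent π occ 0F 3F)
      1324-cells-near 1F 3F = ascent⇒nearˡ (ascent π occ 1F 3F)
      1324-cells-near 2F 3F = ascent⇒nearˡ (ascent π occ 2F 3F)
      1324-cells-near 1F 0F = ascent⇒nearʳ (ascent π occ 0F 1F)
      1324-cells-near 2F 0F = ascent⇒nearʳ (ascent π occ 0F 2F)
      1324-cells-near 3F 0F = ascent⇒nearʳ (ascent π occ 0F 3F)
      1324-cells-near 3F 1F = ascent⇒nearʳ (ascent π occ 1F 3F)
      1324-cells-near 3F 2F = ascent⇒nearʳ (ascent π occ 2F 3F)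
      1324-cells-near 2F 1F = 1324-middle-near
      -- Were the index of the 3 larger by two or more, the 3 would come after the 2.
      1324-cells-near 1F 2F = near λ (2<1 , _) → <-asym (position-< π occ 1F 2F) 2<1

      -- Take for `k` the smallest cell index among the four points.
      1324-in-consecutive-cells :
        ∃ λ k → 1 ℕ.≤ k × Occurrence π p1324 (cell π c k ∪ cell π c (suc k))
      1324-in-consecutive-cells =
        let i , sides = pairwise-near⇒consecutive (c ∘ points) 1324-cells-near
        in c (points i) , positive (points i) ,
           relocate π occ λ a → x∈p∪q⁺ (Sum.map ∈cell ∈cell (sides a))

-- Assembly over all pairs of consecutive cells.

corollary3p3 : ∀ {n : ℕ} (π : Permutation′ n) (c : Fin n → ℕ) →
    IsStaircaseGridding π c →
    IsDominoDecomposition π c →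
    (∀ k l → DominoCell k → ConnectingCell l → Adjacent k l → NonLeavesLieBetween π c k l) →
    Avoids π p1324 ⊤
corollary3p3 π c gridding dominoes between occ =
  let k , 1≤k , occ′ = 1324-in-consecutive-cells π c gridding occ
  in consecutive (consecutive-cells k 1≤k) occ′
  where
  -- The dominoes are indexed by `6 * j + r`, which matches `k` and `suc k` only up to proved
  -- equations.
  transport : ∀ {k l k′ l′} → k ≡ k′ → l ≡ l′ →
    Occurrence π p1324 (cell π c k ∪ cell π c l) →
    Occurrence π p1324 (cell π c k′ ∪ cell π c l′)
  transport refl refl occ′ = occ′
  consecutive : ∀ {k} → ConsecutiveCells k →
    Avoids π p1324 (cell π c k ∪ cell π c (suc k))
  consecutive (inj₁ (inj₁ (j , k≡ , 1+k≡))) occ′ =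
    VerticalDomino.unionAvoids (IsDominoDecomposition.vertical dominoes j)
      (transport k≡ 1+k≡ occ′)
  consecutive (inj₁ (inj₂ (j , k≡ , 1+k≡))) occ′ =
    HorizontalDomino.unionAvoids (IsDominoDecomposition.horizontal dominoes j)
      (transport k≡ 1+k≡ occ′)
  consecutive (inj₂ (inj₁ (domino , connecting))) =
    consecutive-avoids π c gridding _
      (inj₁ (between _ _ domino connecting (inj₁ refl)))
  consecutive (inj₂ (inj₂ (domino , connecting))) =
    consecutive-avoids π c gridding _
      (inj₂ (between _ _ domino connecting (inj₂ refl)))
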